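{- Let $F \colon \mathbf{Set} \to \mathbf{Set}$ be a functor which preserves inclusions and weak wide pullbacks, let $\mathbb{B}$ be a complete lattice, and let $\mathrm{Mod}$ be a set of monotone predicate liftings for $F$ with respect to $\mathbb{B}$ which contains $\Box$ and $\Diamond$. Let $\mathbb A = (Q, \Sigma, \Delta, q_0, \heartsuit)$ be a finite $(F, \mathbb{B})$-automaton. Furthermore, suppose that for each $q \in Q$ there exists $A_q \in F(Q \times \Sigma)$ such that $\mathrm{suppt}(A_q) = \{q\} \times \Sigma$ (and fix such $A_q$). Define an $(F(-) \times \mathcal{P}(\Sigma + \{\checkmark\}))$-coalgebra $\mathbb S = (S, \sigma)$ as follows: \begin{align*} S &:= Q + (Q \times \Sigma), \\ \sigma(s) &:= \begin{cases} (A_q,\, \{\checkmark\}), & \text{if } s = q \in Q \text{ and } \pi_2(\Delta(q)) = 1, \\ (A_q,\, \varnothing), & \text{if } s = q \in Q \text{ and } \pi_2(\Delta(q)) = 0, \\ \big((\pi_1(\Delta(q)))(c),\, \{c\}\big), & \text{if } s = (q, c) \in Q \times \Sigma, \end{cases} \end{align*} where $(FQ)^\Sigma \xleftarrow{\pi_1} (FQ)^\Sigma \times \{0,1\} \xrightarrow{\pi_2} \{0,1\}$ are the projections. Then \[ \left[\!\left[ \left(\mu G^{\bullet \to \bullet}.\lambda X^\bullet.\left(X \lor \bigvee_{c \in \Sigma} G(\widetilde\Diamond(c \land \widetilde\heartsuit X))\right)\right)\checkmark \right]\!\right]_{\mathbb S}^{\mathbb B}(q_0) = \mathrm{val}(\mathbb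 A). \] In particular, $\mathrm{val}(\mathbb A) = \top_{\mathbb B}$ if and only if $\mathbb S, q_0 \Vdash^{\mathbb B} \Big(\mu G^{\bullet \to \bullet}.\lambda X^\bullet.\big(X \lor \bigvee_{c \in \Sigma} G(\widetilde\Diamond(c \land \widetilde\heartsuit X))\big)\Big)\checkmark$.
   Context: **Functors and coalgebras.** For a functor $F \colon \mathbf{Set}\to\mathbf{Set}$, "preserves inclusions" means: if $X \subseteq Y$ then $FX \subseteq FY$ and $F$ sends the inclusion function $X \hookrightarrow Y$ to the inclusion function $FX \hookrightarrow FY$. An $F$-coalgebra is a pair $(S,\sigma)$ with $S$ a set and $\sigma\colon S\to FS$ a function. $\mathcal{P}$ denotes the covariant power set. The sum $+$ is disjoint union; the summands $Q$ and $Q\times\Sigma$ are regarded as subsets of $Q+(Q\times\Sigma)$, so that $FQ$ and $F(Q\times\Sigma)$ are subsets of $F(Q+(Q\times\Sigma))$. For a set $X$ and $A\in FX$, the support is $\mathrm{suppt}(A) := \bigcap\{\,T\subseteq X : A\in FT\,\}$. **Predicate liftings.** $\mathbb{B}$ is a complete lattice with top $\top_{\mathbb B}$, bottom $\bot_{\mathbb B}$, order $\le_{\mathbb B}$. For $n\in\omega$ (including $n=0$), an $n$-ary predicate lifting for $F$ with respect to $\mathbb B$ is a natural transformation $\heartsuit\colon (\hom_{\mathbf{Set}}(-,\mathbb B))^n \Rightarrow \hom_{\mathbf{Set}}(F(-),\mathbb B)$ of functors $\mathbf{Set}^{\mathrm{op}}\to\mathbf{Set}$. It is monotone if for all sets $S$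 and all $f_i,g_i\colon S\to\mathbb B$ with $f_i\le g_i$ pointwise for every $i$, we have $\heartsuit_S(f_1,\dots,f_n)\le\heartsuit_S(g_1,\dots,g_n)$ pointwise on $FS$. "Modality" means a monotone predicate lifting in the given set $\mathrm{Mod}$. When $F$ preserves inclusions and weak wide pullbacks, the unary monotone predicate liftings $\Box,\Diamond$ are defined, for $h\colon S\to\mathbb B$ and $A\in FS$, by $\Box_S(h)(A):=\inf\{h(s):s\in\mathrm{suppt}(A)\}$ and $\Diamond_S(h)(A):=\sup\{h(s):s\in\mathrm{suppt}(A)\}$. **Automata.** An $(F,\mathbb B)$-automaton is a quintuple $\mathbb A=(Q,\Sigma,\Delta,q_0,\heartsuit)$ with $Q$ a non-empty set (states), $\Sigma$ a non-empty set (input symbols), $\Delta\colon Q\to (FQ)^\Sigma\times\{0,1\}$ a function, $q_0\in Q$, and $\heartsuit\in\mathrm{Mod}$ a unary modality. It is finite if $Q$ and $\Sigma$ are finite. With $\pi_1,\pi_2$ the projections of $(FQ)^\Sigma\times\{0,1\}$, define $\mathbb A(q,w)\in\mathbb B$ for $q\in Q$, $w\in\Sigma^*$ inductively: $\mathbb A(q,\varepsilon):=\top_{\mathbb B}$ if $\pi_2(\Delta(q))=1$ and $\bot_{\mathbb B}$ if $\pi_2(\Delta(q))=0$ (with $\varepsilon$ the empty word); and $\mathbb A(q,cw):=\big(\heartsuit_Q(\mathbb A(-,w))\big)\big((\pi_1(\Delta(q)))(c)\big)$ for $c\in\Sigma$, $w\in\Sigma^*$. The value of $\mathbb A$ is $\mathrm{val}(\mathbb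 A):=\sup_{w\in\Sigma^*}\mathbb A(q_0,w)$. **Modalities for $F(-)\times\mathcal P(\Sigma+\{\checkmark\})$.** Here $\checkmark$ is a new symbol, and $F(-)\times\mathcal P(\Sigma+\{\checkmark\})$ acts on a function $f$ as $Ff\times\mathrm{id}$. For each $n$-ary $\heartsuit\in\mathrm{Mod}$, let $\widetilde\heartsuit_S(h_1,\dots,h_n)(A,U):=\heartsuit_S(h_1,\dots,h_n)(A)$ for $A\in FS$, $U\subseteq\Sigma+\{\checkmark\}$. For each $c\in\Sigma+\{\checkmark\}$, there is a nullary modality, also written $c$, with $c_S(A,U):=\top_{\mathbb B}$ if $c\in U$ and $\bot_{\mathbb B}$ otherwise. Let $\widetilde{\mathrm{Mod}}:=\{\widetilde\heartsuit:\heartsuit\in\mathrm{Mod}\}\cup(\Sigma+\{\checkmark\})$; these are monotone predicate liftings for $F(-)\times\mathcal P(\Sigma+\{\checkmark\})$ with respect to $\mathbb B$. **The logic (syntax and typing).** Types: $\tau::=\bullet\mid\tau\to\tau$. For a set $M$ of modalities (each with an arity), formulas are generated by $\varphi::=\top\mid\bot\mid X\mid\varphi\land\varphi\mid\varphi\lor\varphi\mid\heartsuit(\varphi,\dots,\varphi)\mid\lambda X^\tau.\varphi\mid\varphi\varphi\mid\mu X^\tau.\varphi\mid\nu X^\tau.\varphi$, with $X$ ranging over a countably infinite set of variables, $\heartsuit\in M$ applied to as many arguments as its arity, and formulas identified up to $\alpha$-equivalence. Typing judgements $\Gamma\vdash\varphi:\tau$ ($\Gamma$ a finite partial function from variables to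 types) are given by: $\top,\bot:\bullet$; $\Gamma,X:\tau\vdash X:\tau$; $\varphi\land\psi$, $\varphi\lor\psi$ and $\heartsuit(\varphi_1,\dots,\varphi_n)$ have type $\bullet$ if all their immediate subformulas have type $\bullet$; if $\Gamma,X:\tau_1\vdash\varphi:\tau_2$ then $\Gamma\vdash\lambda X^{\tau_1}.\varphi:\tau_1\to\tau_2$; if $\Gamma\vdash\varphi:\tau_1\to\tau_2$ and $\Gamma\vdash\psi:\tau_1$ then $\Gamma\vdash\varphi\psi:\tau_2$; if $\Gamma,X:\tau\vdash\varphi:\tau$ then $\Gamma\vdash\mu X^\tau.\varphi:\tau$ and $\Gamma\vdash\nu X^\tau.\varphi:\tau$. The finite disjunction $\bigvee_{c\in\Sigma}$ abbreviates iterated $\lor$. **Semantics.** Let $G$ be an endofunctor of $\mathbf{Set}$, let the modalities in $M$ be monotone predicate liftings for $G$ with respect to $\mathbb B$, and let $\mathbb S=(S,\sigma)$ be a $G$-coalgebra (in the claim, $G=F(-)\times\mathcal P(\Sigma+\{\checkmark\})$ and $M=\widetilde{\mathrm{Mod}}$). Put $S_\bullet^{\mathbb B}:=\hom_{\mathbf{Set}}(S,\mathbb B)$ with the pointwise order, and let $S_{\tau_1\to\tau_2}^{\mathbb B}$ be the set of monotone functions $S_{\tau_1}^{\mathbb B}\to S_{\tau_2}^{\mathbb B}$ with the pointwise order (all these are complete lattices). For an environment $\eta$ assigning to each variable $X_i:\tau_i$ of $\Gamma$ an element of $S_{\tau_i}^{\mathbb B}$, the interpretation $[\![\Gamma\vdash\varphi:\tau]\!]_{\mathbb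 S}^{\mathbb B}(\eta)\in S_\tau^{\mathbb B}$ is defined by induction: $\top,\bot$ are the top and bottom of $S_\bullet^{\mathbb B}$; $X$ is $\eta(X)$; $\land,\lor$ are binary infimum and supremum in $S_\bullet^{\mathbb B}$; $\heartsuit(\varphi_1,\dots,\varphi_n)$ is $\heartsuit_S(u_1,\dots,u_n)\circ\sigma$ where $u_i$ is the interpretation of $\varphi_i$; $\lambda X^{\tau_1}.\varphi$ is the function sending $f\in S_{\tau_1}^{\mathbb B}$ to the interpretation of $\varphi$ under $\eta[X\mapsto f]$; $\varphi\psi$ is function application; $\mu X^\tau.\varphi$ (resp. $\nu X^\tau.\varphi$) is the least (resp. greatest) fixed point in $S_\tau^{\mathbb B}$ of the interpretation of $\lambda X^\tau.\varphi$. For a closed formula $\varphi$, $[\![\varphi]\!]_{\mathbb S}^{\mathbb B}$ is its interpretation in the empty environment. For $s\in S$ and $\varphi$ closed of type $\bullet$, write $\mathbb S,s\Vdash^{\mathbb B}\varphi$ iff $[\![\varphi]\!]_{\mathbb S}^{\mathbb B}(s)=\top_{\mathbb B}$. -}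

module Defs where

open import Level using (Level; _⊔_; Lift; lift; lower) renaming (suc to lsuc)
open import Data.Bool using (Bool; true; false; if_then_else_)
open import Data.Empty using (⊥)
open import Data.Fin using (Fin; zero; suc)
open import Data.List using (List; []; _∷_)
open import Data.List.Membership.Propositional using (_∈_)
open import Data.List.Relation.Unary.All as All using (All; []; _∷_)
open import Data.List.Relation.Unary.Any using (here; there)
open import Data.Nat using (ℕ; zero; suc)
open import Data.Product using (Σ; ∃; _×_; _,_; proj₁; proj₂)
open import Data.Sum using (_⊎_; inj₁; inj₂)
import Data.Sum.Properties as Sum
open import Data.Unit using (⊤; tt)
import Data.Unit.Properties as Unit
import Data.Fin.Properties as Fin
open import Data.Vec using (Vec; []; _∷_; map)
open import Data.Vec.Relation.Binary.Pointwise.Inductive using (Pointwise; []; _∷_)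
open import Function using (_∘_; id; _↔_; Inverse; Injective)
open import Function.Properties.Inverse using (↔⇒↣)
open import Relation.Binary.Bundles using (Poset)
open import Relation.Binary.Definitions using (DecidableEquality)
open import Relation.Binary.Morphism.Bundles using (PosetHomomorphism; mkPosetHomo)
open import Relation.Binary.PropositionalEquality
  using (_≡_; _≗_; refl; cong)
open import Relation.Nullary using (does)
open import Relation.Unary using (Pred; Irrelevant; ⋂)

-- Everything that is a set in the mathematics lives in `Set ℓ`.  Joins
-- and meets are taken of families indexed one universe higher, because
-- the predicate `suppt` below quantifies over all subsets of a set.
-- (Classically this is no stronger than small completeness: a family
-- can be replaced by its image, a subset of the carrier.)
record CompleteLattice (ℓ : Level) : Set (lsuc (lsuc ℓ)) where
  field
    poset : Poset ℓ ℓ ℓ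
  open Poset poset public
  field
    ⋁          : {I : Set (lsuc ℓ)} → (I → Carrier) → Carrier
    ⋁-upper    : {I : Set (lsuc ℓ)} (x : I → Carrier) (i : I) → x i ≤ ⋁ x
    ⋁-least    : {I : Set (lsuc ℓ)} (x : I → Carrier) (z : Carrier) →
                 (∀ i → x i ≤ z) → ⋁ x ≤ z
    ⋀          : {I : Set (lsuc ℓ)} → (I → Carrier) → Carrier
    ⋀-lower    : {I : Set (lsuc ℓ)} (x : I → Carrier) (i : I) → ⋀ x ≤ x i
    ⋀-greatest : {I : Set (lsuc ℓ)} (x : I → Carrier) (z : Carrier) →
                 (∀ i → z ≤ x i) → z ≤ ⋀ x

  sup inf : {I : Set ℓ} → (I → Carrier) → Carrier
  sup {I} x = ⋁ {Lift (lsuc ℓ) I} (x ∘ lower)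
  inf {I} x = ⋀ {Lift (lsuc ℓ) I} (x ∘ lower)

  ⊤ᴸ ⊥ᴸ : Carrier
  ⊤ᴸ = ⋀ {Lift (lsuc ℓ) ⊥} λ ()
  ⊥ᴸ = ⋁ {Lift (lsuc ℓ) ⊥} λ ()

  infixr 7 _∧ᴸ_
  infixr 6 _∨ᴸ_
  _∧ᴸ_ _∨ᴸ_ : Carrier → Carrier → Carrier
  x ∧ᴸ y = ⋀ {Lift (lsuc ℓ) Bool} λ b → if lower b then x else y
  x ∨ᴸ y = ⋁ {Lift (lsuc ℓ) Bool} λ b → if lower b then x else y

  ⟪_⟫ : Bool → Carrier
  ⟪ b ⟫ = if b then ⊤ᴸ else ⊥ᴸ

  ⋁-mono : {I : Set (lsuc ℓ)} {x y : I → Carrier} → (∀ i → x i ≤ y i) → ⋁ x ≤ ⋁ y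
  ⋁-mono {x = x} {y} p = ⋁-least x (⋁ y) λ i → trans (p i) (⋁-upper y i)

  ⋀-mono : {I : Set (lsuc ℓ)} {x y : I → Carrier} → (∀ i → x i ≤ y i) → ⋀ x ≤ ⋀ y
  ⋀-mono {x = x} {y} p = ⋀-greatest y (⋀ x) λ i → trans (⋀-lower x i) (p i)

  ∧ᴸ-mono : ∀ {x x′ y y′} → x ≤ x′ → y ≤ y′ → (x ∧ᴸ y) ≤ (x′ ∧ᴸ y′)
  ∧ᴸ-mono p q = ⋀-mono λ { (lift true) → p ; (lift false) → q }

  ∨ᴸ-mono : ∀ {x x′ y y′} → x ≤ x′ → y ≤ y′ → (x ∨ᴸ y) ≤ (x′ ∨ᴸ y′)
  ∨ᴸ-mono p q = ⋁-mono λ { (lift true) → p ; (lift false) → q }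

private
  variable
    ℓ m : Level

Mono : CompleteLattice ℓ → CompleteLattice ℓ → Set ℓ
Mono L M = PosetHomomorphism (CompleteLattice.poset L) (CompleteLattice.poset M)

powerLattice : Set ℓ → CompleteLattice ℓ → CompleteLattice ℓ
powerLattice S L = record
  { poset = record
      { Carrier = S → Carrier
      ; _≈_ = λ f g → ∀ s → f s ≈ g s
      ; _≤_ = λ f g → ∀ s → f s ≤ g s
      ; isPartialOrder = record
          { isPreorder = record
              { isEquivalence = record
                  { refl = λ s → Eq.refl
                  ; sym = λ p s → Eq.sym (p s)
                  ; trans = λ p q s → Eq.trans (p s) (q s) }
              ; reflexive = λ p s → reflexive (p s)
              ; trans = λ p q s → L.trans (p s) (q s) }
          ; antisym = λ p q s → antisym (p s) (q s) } }
  ; ⋁ = λ x s → ⋁ λ i → x i s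
  ; ⋁-upper = λ x i s → ⋁-upper (λ j → x j s) i
  ; ⋁-least = λ x z p s → ⋁-least (λ j → x j s) (z s) λ i → p i s
  ; ⋀ = λ x s → ⋀ λ i → x i s
  ; ⋀-lower = λ x i s → ⋀-lower (λ j → x j s) i
  ; ⋀-greatest = λ x z p s → ⋀-greatest (λ j → x j s) (z s) λ i → p i s
  }
  where
  module L = CompleteLattice L
  open CompleteLattice L

monoLattice : CompleteLattice ℓ → CompleteLattice ℓ → CompleteLattice ℓ
monoLattice L M = record
  { poset = record
      { Carrier = Mono L M
      ; _≈_ = λ f g → ∀ x → ⟦ f ⟧ x ≈ ⟦ g ⟧ x
      ; _≤_ = λ f g → ∀ x → ⟦ f ⟧ x ≤ ⟦ g ⟧ x
      ; isPartialOrder = record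
          { isPreorder = record
              { isEquivalence = record
                  { refl = λ x → Eq.refl
                  ; sym = λ p x → Eq.sym (p x)
                  ; trans = λ p q x → Eq.trans (p x) (q x) }
              ; reflexive = λ p x → reflexive (p x)
              ; trans = λ p q x → M.trans (p x) (q x) }
          ; antisym = λ p q x → antisym (p x) (q x) } }
  ; ⋁ = λ f → mkPosetHomo L.poset poset (λ x → ⋁ λ i → ⟦ f i ⟧ x)
               λ x≤y → ⋁-mono λ i → mono (f i) x≤y
  ; ⋁-upper = λ f i x → ⋁-upper (λ j → ⟦ f j ⟧ x) i
  ; ⋁-least = λ f g p x → ⋁-least (λ j → ⟦ f j ⟧ x) (⟦ g ⟧ x) λ i → p i x
  ; ⋀ = λ f → mkPosetHomo L.poset poset (λ x → ⋀ λ i → ⟦ f i ⟧ x)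
               λ x≤y → ⋀-mono λ i → mono (f i) x≤y
  ; ⋀-lower = λ f i x → ⋀-lower (λ j → ⟦ f j ⟧ x) i
  ; ⋀-greatest = λ f g p x → ⋀-greatest (λ j → ⟦ f j ⟧ x) (⟦ g ⟧ x) λ i → p i x
  }
  where
  module L = CompleteLattice L
  module M = CompleteLattice M
  open M
  open PosetHomomorphism using (⟦_⟧; mono)

module FixedPoint (L : CompleteLattice ℓ) where
  open CompleteLattice L
  open PosetHomomorphism using (⟦_⟧; mono)

  IsLeastFixedPoint IsGreatestFixedPoint : Mono L L → Carrier → Set ℓ
  IsLeastFixedPoint    f x = ⟦ f ⟧ x ≈ x × (∀ y → ⟦ f ⟧ y ≈ y → x ≤ y)
  IsGreatestFixedPoint f x = ⟦ f ⟧ x ≈ x × (∀ y → ⟦ f ⟧ y ≈ y → y ≤ x)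

  lfp gfp : Mono L L → Carrier
  lfp f = inf {I = ∃ λ x → ⟦ f ⟧ x ≤ x} proj₁
  gfp f = sup {I = ∃ λ x → x ≤ ⟦ f ⟧ x} proj₁

  lfp-isLeastFixedPoint : ∀ f → IsLeastFixedPoint f (lfp f)
  lfp-isLeastFixedPoint f = antisym pre post , λ y e → below y (reflexive e)
    where
    below : ∀ y → ⟦ f ⟧ y ≤ y → lfp f ≤ y
    below y p = ⋀-lower _ (lift (y , p))
    pre : ⟦ f ⟧ (lfp f) ≤ lfp f
    pre = ⋀-greatest _ _ λ { (lift (y , p)) → trans (mono f (below y p)) p }
    post : lfp f ≤ ⟦ f ⟧ (lfp f)
    post = below _ (mono f pre)

  gfp-isGreatestFixedPoint : ∀ f → IsGreatestFixedPoint f (gfp f)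
  gfp-isGreatestFixedPoint f = antisym pre post , λ y e → above y (reflexive (Eq.sym e))
    where
    above : ∀ y → y ≤ ⟦ f ⟧ y → y ≤ gfp f
    above y p = ⋁-upper _ (lift (y , p))
    post : gfp f ≤ ⟦ f ⟧ (gfp f)
    post = ⋁-least _ _ λ { (lift (y , p)) → trans p (mono f (above y p)) }
    pre : ⟦ f ⟧ (gfp f) ≤ gfp f
    pre = above _ (mono f post)

  lfp-mono : ∀ {f g} → (∀ x → ⟦ f ⟧ x ≤ ⟦ g ⟧ x) → lfp f ≤ lfp g
  lfp-mono f≤g =
    ⋀-greatest _ _ λ { (lift (y , p)) → ⋀-lower _ (lift (y , trans (f≤g y) p)) }

  gfp-mono : ∀ {f g} → (∀ x → ⟦ f ⟧ x ≤ ⟦ g ⟧ x) → gfp f ≤ gfp g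
  gfp-mono f≤g =
    ⋁-least _ _ λ { (lift (y , p)) → ⋁-upper _ (lift (y , trans p (f≤g y))) }

-- Functions are compared pointwise; `F-cong` is automatic in the
-- presence of function extensionality.
record SetFunctor (ℓ : Level) : Set (lsuc ℓ) where
  field
    F₀     : Set ℓ → Set ℓ
    F₁     : {X Y : Set ℓ} → (X → Y) → F₀ X → F₀ Y
    F-id   : {X : Set ℓ} → F₁ (id {A = X}) ≗ id
    F-∘    : {X Y Z : Set ℓ} (g : Y → Z) (f : X → Y) → F₁ (g ∘ f) ≗ F₁ g ∘ F₁ f
    F-cong : {X Y : Set ℓ} {f g : X → Y} → f ≗ g → F₁ f ≗ F₁ g

record Subset (X : Set ℓ) : Set (lsuc ℓ) where
  field
    pred       : Pred X ℓ
    irrelevant : Irrelevant pred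

  Elem : Set ℓ
  Elem = Σ X pred

  incl : Elem → X
  incl = proj₁

open Subset public

module _ (F : SetFunctor ℓ) where
  open SetFunctor F

  -- A subset T of X is a type of its own, with inclusion `incl T`.
  -- That F preserves inclusions means that `F₁ (incl T)` exhibits
  -- `F₀ (Elem T)` as a subset of `F₀ X`; membership in this subset is
  -- `_∈F_` below.
  PreservesInclusions : Set (lsuc ℓ)
  PreservesInclusions = {X : Set ℓ} (T : Subset X) → Injective _≡_ _≡_ (F₁ (incl T))

  infix 4 _∈F_
  _∈F_ : {X : Set ℓ} → F₀ X → Subset X → Set ℓ
  A ∈F T = ∃ λ (a : F₀ (Elem T)) → F₁ (incl T) a ≡ A

  suppt : {X : Set ℓ} → F₀ X → Pred X (lsuc ℓ)
  suppt {X} A = ⋂ (∃ λ (T : Subset X) → A ∈F T) (pred ∘ proj₁)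

-- A cone over the wide cospan `(f i : X i → Y)ᵢ` consists of maps
-- `p i : P → X i` and `r : P → Y` with `f i ∘ p i = r` for all i.
record IsWeakWidePullback {I : Set ℓ} {X : I → Set ℓ} {Y : Set ℓ} (f : ∀ i → X i → Y)
                          (P : Set ℓ) (p : ∀ i → P → X i) (r : P → Y) : Set (lsuc ℓ) where
  field
    commutes : ∀ i → f i ∘ p i ≗ r
    mediate  : (Z : Set ℓ) (z : ∀ i → Z → X i) (t : Z → Y) → (∀ i → f i ∘ z i ≗ t) →
               ∃ λ (u : Z → P) → (∀ i → p i ∘ u ≗ z i) × (r ∘ u ≗ t)

PreservesWeakWidePullbacks : SetFunctor ℓ → Set (lsuc ℓ)
PreservesWeakWidePullbacks {ℓ} F =
  {I : Set ℓ} {X : I → Set ℓ} {Y : Set ℓ} (f : ∀ i → X i → Y)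
  (P : Set ℓ) (p : ∀ i → P → X i) (r : P → Y) →
  IsWeakWidePullback f P p r →
  IsWeakWidePullback (λ i → F₁ (f i)) (F₀ P) (λ i → F₁ (p i)) (F₁ r)
  where open SetFunctor F

record Coalgebra (F : SetFunctor ℓ) : Set (lsuc ℓ) where
  constructor coalg
  open SetFunctor F
  field
    State : Set ℓ
    step  : State → F₀ State

record MonotonePredicateLifting (F : SetFunctor ℓ) (𝔹 : CompleteLattice ℓ) (n : ℕ) : Set (lsuc ℓ) where
  open SetFunctor F
  open CompleteLattice 𝔹
  field
    component : (S : Set ℓ) → Vec (S → Carrier) n → F₀ S → Carrier
    natural   : {X Y : Set ℓ} (f : X → Y) (hs : Vec (Y → Carrier) n) (A : F₀ X) →
                component X (map (_∘ f) hs) A ≈ component Y hs (F₁ f A)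
    monotone  : {S : Set ℓ} {fs gs : Vec (S → Carrier) n} →
                Pointwise (λ f g → ∀ s → f s ≤ g s) fs gs →
                ∀ A → component S fs A ≤ component S gs A

open MonotonePredicateLifting public

-- A set of monotone predicate liftings, as a family indexed by modality
-- symbols sorted by arity.
record Modalities (m : Level) (F : SetFunctor ℓ) (𝔹 : CompleteLattice ℓ) : Set (lsuc (ℓ ⊔ m)) where
  field
    Op      : ℕ → Set m
    lifting : {n : ℕ} → Op n → MonotonePredicateLifting F 𝔹 n

module _ (F : SetFunctor ℓ) (𝔹 : CompleteLattice ℓ) where
  open SetFunctor F
  open CompleteLattice 𝔹

  box diamond : (S : Set ℓ) → (S → Carrier) → F₀ S → Carrier
  box     S h A = ⋀ {I = ∃ (suppt F A)} (h ∘ proj₁)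
  diamond S h A = ⋁ {I = ∃ (suppt F A)} (h ∘ proj₁)

  Is□ Is◇ : MonotonePredicateLifting F 𝔹 1 → Set (lsuc ℓ)
  Is□ ♥ = ∀ S h A → component ♥ S (h ∷ []) A ≈ box S h A
  Is◇ ♥ = ∀ S h A → component ♥ S (h ∷ []) A ≈ diamond S h A

Finite : Set ℓ → Set ℓ
Finite X = ∃ λ n → X ↔ Fin n

Finite⇒≟ : {X : Set ℓ} → Finite X → DecidableEquality X
Finite⇒≟ (n , X↔Fin) = Fin.inj⇒≟ (↔⇒↣ X↔Fin)

-- `Q` is non-empty because of `q₀`.
record Automaton {F : SetFunctor ℓ} {𝔹 : CompleteLattice ℓ} (Mod : Modalities m F 𝔹) : Set (lsuc ℓ ⊔ m) where
  open SetFunctor F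
  open CompleteLattice 𝔹
  open Modalities Mod
  field
    Q Sym        : Set ℓ
    Sym-nonEmpty : Sym
    Δ            : Q → (Sym → F₀ Q) × Bool
    q₀           : Q
    ♥            : Op 1

  accept : Q → List Sym → Carrier
  accept q []      = ⟪ proj₂ (Δ q) ⟫
  accept q (c ∷ w) = component (lifting ♥) Q ((λ q′ → accept q′ w) ∷ []) (proj₁ (Δ q) c)

  val : Carrier
  val = sup λ (w : List Sym) → accept q₀ w

  record IsFinite : Set ℓ where
    field
      Q-finite   : Finite Q
      Sym-finite : Finite Sym

-- `Sym ⊎ ⊤` is Σ + {✓}.  Subsets are characteristic functions, which is
-- what deciding `c ∈ U` in the nullary modality c requires.
𝒫 : Set ℓ → Set ℓ
𝒫 X = X → Bool

∅ : {X : Set ℓ} → 𝒫 X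
∅ _ = false

singleton : {X : Set ℓ} → DecidableEquality X → X → 𝒫 X
singleton _≟_ x y = does (x ≟ y)

✓ : {Sym : Set ℓ} → Sym ⊎ ⊤
✓ = inj₂ tt

_×𝒫⁺_ : SetFunctor ℓ → Set ℓ → SetFunctor ℓ
F ×𝒫⁺ Sym = record
  { F₀     = λ X → F₀ X × 𝒫 (Sym ⊎ ⊤)
  ; F₁     = λ f (A , U) → F₁ f A , U
  ; F-id   = λ (A , U) → cong (_, U) (F-id A)
  ; F-∘    = λ g f (A , U) → cong (_, U) (F-∘ g f A)
  ; F-cong = λ f≗g (A , U) → cong (_, U) (F-cong f≗g A)
  }
  where open SetFunctor F

-- Coinciding liftings in Mod~ may have distinct symbols here, which does
-- not affect the interpretation of any formula.
data Op⁺ (Op : ℕ → Set m) (Sym : Set ℓ) : ℕ → Set (ℓ ⊔ m) where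
  tilde  : {n : ℕ} → Op n → Op⁺ Op Sym n
  letter : Sym ⊎ ⊤ → Op⁺ Op Sym 0

extend : {F : SetFunctor ℓ} {𝔹 : CompleteLattice ℓ} → Modalities m F 𝔹 →
         (Sym : Set ℓ) → Modalities (ℓ ⊔ m) (F ×𝒫⁺ Sym) 𝔹
extend {F = F} {𝔹} Mod Sym = record
  { Op = Op⁺ Op Sym
  ; lifting = λ
      { (tilde ♥) → record
          { component = λ S hs (A , U) → component (lifting ♥) S hs A
          ; natural   = λ f hs (A , U) → natural (lifting ♥) f hs A
          ; monotone  = λ fs≤gs (A , U) → monotone (lifting ♥) fs≤gs A
          }
      ; (letter c) → record
          { component = λ S hs (A , U) → ⟪ U c ⟫
          ; natural   = λ f hs (A , U) → Eq.refl
          ; monotone  = λ fs≤gs (A , U) → reflexive Eq.refl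
          }
      }
  }
  where
  open Modalities Mod
  open CompleteLattice 𝔹

infixr 5 _⇒_
data Type : Set where
  •   : Type
  _⇒_ : Type → Type → Type

Ctx : Set
Ctx = List Type

private
  variable
    Γ     : Ctx
    τ τ₁ τ₂ : Type

-- Derivations Γ ⊢ φ : τ.  Formulas modulo α-equivalence are rendered by
-- typed de Bruijn indices, so that a formula is its typing derivation.
data Formula (Op : ℕ → Set m) : Ctx → Type → Set m where
  tru fls : Formula Op Γ •
  var     : τ ∈ Γ → Formula Op Γ τ
  _∧_ _∨_ : Formula Op Γ • → Formula Op Γ • → Formula Op Γ •
  mod     : {n : ℕ} → Op n → Vec (Formula Op Γ •) n → Formula Op Γ •
  ƛ       : Formula Op (τ₁ ∷ Γ) τ₂ → Formula Op Γ (τ₁ ⇒ τ₂)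
  _·_     : Formula Op Γ (τ₁ ⇒ τ₂) → Formula Op Γ τ₁ → Formula Op Γ τ₂
  μ ν     : Formula Op (τ ∷ Γ) τ → Formula Op Γ τ

infixr 7 _∧_
infixr 6 _∨_
infixl 8 _·_

-- The clause for zero is not reached for the (non-empty) alphabet of an
-- automaton.
⋁ᶠ : {Op : ℕ → Set m} (n : ℕ) → (Fin n → Formula Op Γ •) → Formula Op Γ •
⋁ᶠ zero          φ = fls
⋁ᶠ (suc zero)    φ = φ zero
⋁ᶠ (suc (suc n)) φ = φ zero ∨ ⋁ᶠ (suc n) (φ ∘ suc)

⋁[_] : {Op : ℕ → Set m} {X : Set ℓ} → Finite X → (X → Formula Op Γ •) → Formula Op Γ •
⋁[ n , X↔Fin ] φ = ⋁ᶠ n (φ ∘ Inverse.from X↔Fin)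

module Semantics {G : SetFunctor ℓ} {𝔹 : CompleteLattice ℓ} (M : Modalities m G 𝔹)
                 (𝕊 : Coalgebra G) where
  open Modalities M
  open Coalgebra 𝕊
  open CompleteLattice

  ⟦_⟧ᵀ : Type → CompleteLattice ℓ
  ⟦ • ⟧ᵀ       = powerLattice State 𝔹
  ⟦ τ₁ ⇒ τ₂ ⟧ᵀ = monoLattice ⟦ τ₁ ⟧ᵀ ⟦ τ₂ ⟧ᵀ

  Env : Ctx → Set ℓ
  Env = All λ τ → Carrier ⟦ τ ⟧ᵀ

  _≤ᴱ_ : Env Γ → Env Γ → Set ℓ
  _≤ᴱ_ {Γ} η η′ = ∀ {τ} (x : τ ∈ Γ) → _≤_ ⟦ τ ⟧ᵀ (All.lookup η x) (All.lookup η′ x)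

  ≤ᵀ-refl : (τ : Type) (a : Carrier ⟦ τ ⟧ᵀ) → _≤_ ⟦ τ ⟧ᵀ a a
  ≤ᵀ-refl τ a = reflexive ⟦ τ ⟧ᵀ {a} {a} (Eq.refl ⟦ τ ⟧ᵀ {a})

  ≤ᴱ-refl : (η : Env Γ) → η ≤ᴱ η
  ≤ᴱ-refl η {τ} x = ≤ᵀ-refl τ (All.lookup η x)

  ∷-mono : (τ : Type) {η η′ : Env Γ} {a a′ : Carrier ⟦ τ ⟧ᵀ} →
           η ≤ᴱ η′ → _≤_ ⟦ τ ⟧ᵀ a a′ → _≤ᴱ_ {τ ∷ Γ} (a ∷ η) (a′ ∷ η′)
  ∷-mono τ p q (here refl) = q
  ∷-mono τ p q (there x)   = p x

  -- The interpretation of a formula is defined together with its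
  -- monotonicity in the environment, on which the cases of ƛ, μ and ν
  -- depend.
  mutual
    ⟦_⟧ : Formula Op Γ τ → Env Γ → Carrier ⟦ τ ⟧ᵀ
    ⟦ tru ⟧ η           = ⊤ᴸ ⟦ • ⟧ᵀ
    ⟦ fls ⟧ η           = ⊥ᴸ ⟦ • ⟧ᵀ
    ⟦ var x ⟧ η         = All.lookup η x
    ⟦ φ ∧ ψ ⟧ η         = _∧ᴸ_ ⟦ • ⟧ᵀ (⟦ φ ⟧ η) (⟦ ψ ⟧ η)
    ⟦ φ ∨ ψ ⟧ η         = _∨ᴸ_ ⟦ • ⟧ᵀ (⟦ φ ⟧ η) (⟦ ψ ⟧ η)
    ⟦ mod ♥ φs ⟧ η      = component (lifting ♥) State (⟦ φs ⟧* η) ∘ step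
    ⟦ ƛ φ ⟧ η           = abstr φ η
    ⟦ φ · ψ ⟧ η         = PosetHomomorphism.⟦_⟧ (⟦ φ ⟧ η) (⟦ ψ ⟧ η)
    ⟦ μ {τ = τ} φ ⟧ η   = FixedPoint.lfp ⟦ τ ⟧ᵀ (abstr φ η)
    ⟦ ν {τ = τ} φ ⟧ η   = FixedPoint.gfp ⟦ τ ⟧ᵀ (abstr φ η)

    ⟦_⟧* : {n : ℕ} → Vec (Formula Op Γ •) n → Env Γ → Vec (State → Carrier 𝔹) n
    ⟦ [] ⟧* η     = []
    ⟦ φ ∷ φs ⟧* η = ⟦ φ ⟧ η ∷ ⟦ φs ⟧* η

    abstr : Formula Op (τ₁ ∷ Γ) τ₂ → Env Γ → Mono ⟦ τ₁ ⟧ᵀ ⟦ τ₂ ⟧ᵀ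
    abstr {τ₁ = τ₁} {τ₂ = τ₂} φ η =
      mkPosetHomo (poset ⟦ τ₁ ⟧ᵀ) (poset ⟦ τ₂ ⟧ᵀ) (λ a → ⟦ φ ⟧ (a ∷ η))
                  (λ a≤b → ⟦ φ ⟧-mono (∷-mono τ₁ (≤ᴱ-refl η) a≤b))

    ⟦_⟧-mono : (φ : Formula Op Γ τ) {η η′ : Env Γ} → η ≤ᴱ η′ →
               _≤_ ⟦ τ ⟧ᵀ (⟦ φ ⟧ η) (⟦ φ ⟧ η′)
    ⟦ tru ⟧-mono p         = ≤ᵀ-refl • (⊤ᴸ ⟦ • ⟧ᵀ)
    ⟦ fls ⟧-mono p         = ≤ᵀ-refl • (⊥ᴸ ⟦ • ⟧ᵀ)
    ⟦ var x ⟧-mono p       = p x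
    ⟦ φ ∧ ψ ⟧-mono p       = ∧ᴸ-mono ⟦ • ⟧ᵀ (⟦ φ ⟧-mono p) (⟦ ψ ⟧-mono p)
    ⟦ φ ∨ ψ ⟧-mono p       = ∨ᴸ-mono ⟦ • ⟧ᵀ (⟦ φ ⟧-mono p) (⟦ ψ ⟧-mono p)
    ⟦ mod ♥ φs ⟧-mono p s  = monotone (lifting ♥) (⟦ φs ⟧*-mono p) (step s)
    ⟦ ƛ {τ₁ = τ₁} φ ⟧-mono p a = ⟦ φ ⟧-mono (∷-mono τ₁ p (≤ᵀ-refl τ₁ a))
    ⟦ _·_ {τ₁ = τ₁} {τ₂ = τ₂} φ ψ ⟧-mono {η} {η′} p =
      trans ⟦ τ₂ ⟧ᵀ (⟦ φ ⟧-mono p (⟦ ψ ⟧ η))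
                    (PosetHomomorphism.mono (⟦ φ ⟧ η′) (⟦ ψ ⟧-mono p))
    ⟦ μ {τ = τ} φ ⟧-mono {η} {η′} p =
      FixedPoint.lfp-mono ⟦ τ ⟧ᵀ {abstr φ η} {abstr φ η′} λ a →
        ⟦ φ ⟧-mono (∷-mono τ p (≤ᵀ-refl τ a))
    ⟦ ν {τ = τ} φ ⟧-mono {η} {η′} p =
      FixedPoint.gfp-mono ⟦ τ ⟧ᵀ {abstr φ η} {abstr φ η′} λ a →
        ⟦ φ ⟧-mono (∷-mono τ p (≤ᵀ-refl τ a))

    ⟦_⟧*-mono : {n : ℕ} (φs : Vec (Formula Op Γ •) n) {η η′ : Env Γ} → η ≤ᴱ η′ →
                Pointwise (λ f g → ∀ s → _≤_ 𝔹 (f s) (g s)) (⟦ φs ⟧* η) (⟦ φs ⟧* η′)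
    ⟦ [] ⟧*-mono p     = []
    ⟦ φ ∷ φs ⟧*-mono p = ⟦ φ ⟧-mono p ∷ ⟦ φs ⟧*-mono p

  ⟦_⟧₀ : Formula Op [] τ → Carrier ⟦ τ ⟧ᵀ
  ⟦ φ ⟧₀ = ⟦ φ ⟧ []

  infix 4 _⊩_
  _⊩_ : State → Formula Op [] • → Set ℓ
  s ⊩ φ = _≈_ 𝔹 (⟦ φ ⟧₀ s) (⊤ᴸ 𝔹)

module _ {F : SetFunctor ℓ} {𝔹 : CompleteLattice ℓ} {Mod : Modalities m F 𝔹}
         (𝔸 : Automaton Mod) (fin : Automaton.IsFinite 𝔸) where
  open SetFunctor F
  open Modalities Mod
  open Automaton 𝔸
  open IsFinite fin

  private
    ⁅_⁆ : Sym ⊎ ⊤ → 𝒫 (Sym ⊎ ⊤)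
    ⁅_⁆ = singleton (Sum.≡-dec (Finite⇒≟ Sym-finite) Unit._≟_)

  automatonCoalgebra : (Q → F₀ (Q × Sym)) → Coalgebra (F ×𝒫⁺ Sym)
  automatonCoalgebra A = coalg (Q ⊎ (Q × Sym)) λ
    { (inj₁ q)       → F₁ inj₂ (A q) , (if proj₂ (Δ q) then ⁅ ✓ ⁆ else ∅)
    ; (inj₂ (q , c)) → F₁ inj₁ (proj₁ (Δ q) c) , ⁅ inj₁ c ⁆
    }

  -- (μG. λX. X ∨ ⋁_{c∈Σ} G(◇~(c ∧ ♥~X))) ✓
  reachFormula : Op 1 → Formula (Op⁺ Op Sym) [] •
  reachFormula ◇ =
    μ (ƛ (X ∨ ⋁[ Sym-finite ] λ c →
            G · mod (tilde ◇) ((mod (letter (inj₁ c)) [] ∧ mod (tilde ♥) (X ∷ [])) ∷ [])))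
    · mod (letter ✓) []
    where
    X : Formula (Op⁺ Op Sym) (• ∷ (• ⇒ •) ∷ []) •
    X = var (here refl)
    G : Formula (Op⁺ Op Sym) (• ∷ (• ⇒ •) ∷ []) (• ⇒ •)
    G = var (there (here refl))

{-# OPTIONS --safe #-}

-- Unfolding the fixed point, G X is the join over all words w of the
-- predicates obtained from X by prefixing the letters of w one after the
-- other, where prefixing c sends X to ◇(c ∧ ♥ X).  By naturality of ◇ and
-- suppt (A q) = {q} × Σ, prefixing c acts on predicates restricted to Q as
-- a c-transition of the automaton.  The letter prefixed last is read
-- first, so w contributes the value of the reversed word.
module Submission where

open import Defs
open import Level using (Level; lift; lower)
open import Data.Bool using (true; false)
open import Data.Fin using (Fin; zero; suc)
open import Data.List using (List; []; _∷_; _ʳ++_; reverse)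
open import Data.List.Properties using (reverse-involutive)
open import Data.List.Relation.Unary.All using ([]; _∷_)
open import Data.List.Relation.Unary.Any using (here; there)
open import Data.Nat using (zero; suc)
open import Data.Product using (_×_; _,_; proj₁; proj₂)
open import Data.Sum using (inj₁; inj₂)
open import Data.Vec using ([]; _∷_)
open import Data.Vec.Relation.Binary.Pointwise.Inductive using ([]; _∷_)
open import Function using (_∘_; _⇔_; mk⇔; Inverse)
open import Relation.Binary.Morphism.Bundles using (PosetHomomorphism)
import Relation.Binary.Morphism.Construct.Composition as Comp
import Relation.Binary.Morphism.Construct.Identity as Id
open import Relation.Binary.PropositionalEquality as ≡ using (_≡_; refl; cong; subst)
open import Relation.Nullary using (Dec; yes; no; does; contradiction)
open import Relation.Unary using (_≐_; ｛_｝; _⟨×⟩_; U)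

private
  variable
    ℓ m : Level
    Γ : Ctx

open PosetHomomorphism using () renaming (⟦_⟧ to _$_)

module LatticeProperties (L : CompleteLattice ℓ) where
  open CompleteLattice L

  x≤x∨ᴸy : ∀ x y → x ≤ x ∨ᴸ y
  x≤x∨ᴸy x y = ⋁-upper _ (lift true)

  y≤x∨ᴸy : ∀ x y → y ≤ x ∨ᴸ y
  y≤x∨ᴸy x y = ⋁-upper _ (lift false)

  ∨ᴸ-least : ∀ x y z → x ≤ z → y ≤ z → x ∨ᴸ y ≤ z
  ∨ᴸ-least x y z p q = ⋁-least _ z λ { (lift true) → p ; (lift false) → q }

  x∧ᴸy≤x : ∀ x y → x ∧ᴸ y ≤ x
  x∧ᴸy≤x x y = ⋀-lower _ (lift true)

  x∧ᴸy≤y : ∀ x y → x ∧ᴸ y ≤ y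
  x∧ᴸy≤y x y = ⋀-lower _ (lift false)

  ∧ᴸ-greatest : ∀ x y z → z ≤ x → z ≤ y → z ≤ x ∧ᴸ y
  ∧ᴸ-greatest x y z p q = ⋀-greatest _ z λ { (lift true) → p ; (lift false) → q }

  ⊥ᴸ-min : ∀ x → ⊥ᴸ ≤ x
  ⊥ᴸ-min x = ⋁-least _ x λ ()

  ⊤ᴸ-max : ∀ x → x ≤ ⊤ᴸ
  ⊤ᴸ-max x = ⋀-greatest _ x λ ()

  -- The guard is the value of a letter modality at a state `inj₂ (q , d)`, with `P` being `d ≡ c`.
  -- A failed guard collapses the meet to bottom, so only the positive case has content.
  guard-least : {P : Set ℓ} (P? : Dec P) (x y : Carrier) → (P → x ≤ y) → ⟪ does P? ⟫ ∧ᴸ x ≤ y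
  guard-least (yes p) x y x≤y = trans (x∧ᴸy≤y ⊤ᴸ x) (x≤y p)
  guard-least (no _)  x y x≤y = trans (x∧ᴸy≤x ⊥ᴸ x) (⊥ᴸ-min y)

  ≤-guard : {P : Set ℓ} (P? : Dec P) (x : Carrier) → P → x ≤ ⟪ does P? ⟫ ∧ᴸ x
  ≤-guard (yes _) x p = ∧ᴸ-greatest ⊤ᴸ x x (⊤ᴸ-max x) (reflexive Eq.refl)
  ≤-guard (no ¬p) x p = contradiction p ¬p

  sup-upper : {I : Set ℓ} (x : I → Carrier) (i : I) → x i ≤ sup x
  sup-upper x i = ⋁-upper _ (lift i)

  sup-least : {I : Set ℓ} (x : I → Carrier) (z : Carrier) → (∀ i → x i ≤ z) → sup x ≤ z
  sup-least x z p = ⋁-least _ z (p ∘ lower)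

  lfp-least : (f : Mono L L) (y : Carrier) → (f $ y) ≤ y → FixedPoint.lfp L f ≤ y
  lfp-least f y p = ⋀-lower _ (lift (y , p))

  lfp-prefixed : (f : Mono L L) → (f $ FixedPoint.lfp L f) ≤ FixedPoint.lfp L f
  lfp-prefixed f = reflexive (proj₁ (FixedPoint.lfp-isLeastFixedPoint L f))

-- Not definitional: the case distinction on `Bool` inside `_∧ᴸ_` does not
-- commute with evaluation at s.
powerLattice-∧ᴸ : (S : Set ℓ) (L : CompleteLattice ℓ) (f g : S → CompleteLattice.Carrier L) (s : S) →
                  let open CompleteLattice L in
                  CompleteLattice._∧ᴸ_ (powerLattice S L) f g s ≈ (f s ∧ᴸ g s)
powerLattice-∧ᴸ S L f g s = antisym
  (∧ᴸ-greatest (f s) (g s) _ (PP.x∧ᴸy≤x f g s) (PP.x∧ᴸy≤y f g s))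
  (⋀-greatest _ _ λ { (lift true) → x∧ᴸy≤x (f s) (g s) ; (lift false) → x∧ᴸy≤y (f s) (g s) })
  where
  open CompleteLattice L
  open LatticeProperties L
  module PP = LatticeProperties (powerLattice S L)

module _ {F : SetFunctor ℓ} {𝔹 : CompleteLattice ℓ} where
  open SetFunctor F
  open CompleteLattice 𝔹

  -- Liftings carry no congruence law for the setoid equality `≈`; monotonicity in both directions
  -- supplies it.
  component-cong : (♥ : MonotonePredicateLifting F 𝔹 1) {X : Set ℓ} {f g : X → Carrier} →
                   (∀ x → f x ≈ g x) → ∀ B → component ♥ X (f ∷ []) B ≈ component ♥ X (g ∷ []) B
  component-cong ♥ f≈g B =
    antisym (monotone ♥ ((λ x → reflexive (f≈g x)) ∷ []) B)
            (monotone ♥ ((λ x → reflexive (Eq.sym (f≈g x))) ∷ []) B)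

module BigDisjunction {G : SetFunctor ℓ} {𝔹 : CompleteLattice ℓ} (M : Modalities m G 𝔹)
                      (𝕊 : Coalgebra G) where
  open Modalities M
  open Semantics M 𝕊
  open CompleteLattice ⟦ • ⟧ᵀ
  open LatticeProperties ⟦ • ⟧ᵀ

  ⋁ᶠ-upper : ∀ n (φ : Fin n → Formula Op Γ •) η i → ⟦ φ i ⟧ η ≤ ⟦ ⋁ᶠ n φ ⟧ η
  ⋁ᶠ-upper (suc zero)    φ η zero    = ≤ᵀ-refl • (⟦ φ zero ⟧ η)
  ⋁ᶠ-upper (suc (suc n)) φ η zero    = x≤x∨ᴸy (⟦ φ zero ⟧ η) (⟦ ⋁ᶠ (suc n) (φ ∘ suc) ⟧ η)
  ⋁ᶠ-upper (suc (suc n)) φ η (suc i) =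
    trans {⟦ φ (suc i) ⟧ η} {⟦ ⋁ᶠ (suc n) (φ ∘ suc) ⟧ η}
      (⋁ᶠ-upper (suc n) (φ ∘ suc) η i)
      (y≤x∨ᴸy (⟦ φ zero ⟧ η) (⟦ ⋁ᶠ (suc n) (φ ∘ suc) ⟧ η))

  ⋁ᶠ-least : ∀ n (φ : Fin n → Formula Op Γ •) η z → (∀ i → ⟦ φ i ⟧ η ≤ z) → ⟦ ⋁ᶠ n φ ⟧ η ≤ z
  ⋁ᶠ-least zero          φ η z p = ⊥ᴸ-min z
  ⋁ᶠ-least (suc zero)    φ η z p = p zero
  ⋁ᶠ-least (suc (suc n)) φ η z p =
    ∨ᴸ-least (⟦ φ zero ⟧ η) (⟦ ⋁ᶠ (suc n) (φ ∘ suc) ⟧ η) z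
      (p zero) (⋁ᶠ-least (suc n) (φ ∘ suc) η z (p ∘ suc))

  module _ {X : Set ℓ} (fin : Finite X) (φ : X → Formula Op Γ •) (η : Env Γ) where
    private
      n = proj₁ fin
      open Inverse (proj₂ fin)

    ⋁[]-upper : ∀ x → ⟦ φ x ⟧ η ≤ ⟦ ⋁[ fin ] φ ⟧ η
    -- The index `to x` contributes the disjunct at `from (to x)`, which is `x`.
    ⋁[]-upper x = subst (λ y → ⟦ φ y ⟧ η ≤ ⟦ ⋁[ fin ] φ ⟧ η) (strictlyInverseʳ x)
                        (⋁ᶠ-upper n (φ ∘ from) η (to x))

    ⋁[]-least : ∀ z → (∀ x → ⟦ φ x ⟧ η ≤ z) → ⟦ ⋁[ fin ] φ ⟧ η ≤ z
    ⋁[]-least z p = ⋁ᶠ-least n (φ ∘ from) η z (p ∘ from)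

module Reachability
  {F : SetFunctor ℓ} {𝔹 : CompleteLattice ℓ} {Mod : Modalities m F 𝔹}
  (◇ : Modalities.Op Mod 1) (is◇ : Is◇ F 𝔹 (Modalities.lifting Mod ◇))
  (𝔸 : Automaton Mod) (fin : Automaton.IsFinite 𝔸)
  (A : Automaton.Q 𝔸 → SetFunctor.F₀ F (Automaton.Q 𝔸 × Automaton.Sym 𝔸))
  (suppt-A : ∀ q → suppt F (A q) ≐ (｛ q ｝ ⟨×⟩ U))
  where
  open SetFunctor F
  open Modalities Mod
  open Automaton 𝔸
  open IsFinite fin
  open Semantics (extend Mod Sym) (automatonCoalgebra 𝔸 fin A)
  open BigDisjunction (extend Mod Sym) (automatonCoalgebra 𝔸 fin A)
  open Coalgebra (automatonCoalgebra 𝔸 fin A) using (State; step)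

  private
    module B = CompleteLattice 𝔹
    module BP = LatticeProperties 𝔹
    module P = CompleteLattice ⟦ • ⟧ᵀ
    module PP = LatticeProperties ⟦ • ⟧ᵀ
    module T = CompleteLattice ⟦ • ⇒ • ⟧ᵀ
    module TP = LatticeProperties ⟦ • ⇒ • ⟧ᵀ

  open B using (_≈_; _≤_; _∧ᴸ_; ⟪_⟫)

  -- Kept over an arbitrary `Γ` because it is read both below the binder of `G` and, with `Γ` empty,
  -- as the operator `prefix c`. Only the head of the environment enters, so both readings agree by
  -- computation.
  prefixFormula : Sym → Formula (Op⁺ Op Sym) (• ∷ Γ) •
  prefixFormula c =
    mod (tilde ◇) ((mod (letter (inj₁ c)) [] ∧ mod (tilde ♥) (var (here refl) ∷ [])) ∷ [])

  prefix : Sym → T.Carrier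
  prefix c = abstr (prefixFormula c) []

  -- `prefix c` acts first, so the head of the list ends up innermost. This order follows the
  -- recursion of the formula, which calls `G` on the prefixed argument.
  prefixes : List Sym → T.Carrier
  prefixes []      = Id.posetHomomorphism P.poset
  prefixes (c ∷ w) = Comp.posetHomomorphism (prefix c) (prefixes w)

  unfoldBody : Formula (Op⁺ Op Sym) (• ∷ (• ⇒ •) ∷ []) •
  unfoldBody = var (here refl) ∨ ⋁[ Sym-finite ] λ c → var (there (here refl)) · prefixFormula c

  unfold : Mono ⟦ • ⇒ • ⟧ᵀ ⟦ • ⇒ • ⟧ᵀ
  unfold = abstr (ƛ unfoldBody) []

  reach : T.Carrier
  reach = FixedPoint.lfp ⟦ • ⇒ • ⟧ᵀ unfold

  -- The disjunct `X` is the contribution of the empty word. Since `G` stands in head position and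
  -- joins of functions are pointwise, the disjunct for `c` is exactly the join of the contributions
  -- of the words `c ∷ w`.
  prefixes-prefixed : (unfold $ T.sup prefixes) T.≤ T.sup prefixes
  prefixes-prefixed f =
    PP.∨ᴸ-least f _ (T.sup prefixes $ f)
      (TP.sup-upper prefixes [] f)
      (⋁[]-least Sym-finite (λ c → var (there (here refl)) · prefixFormula c)
        (f ∷ T.sup prefixes ∷ []) (T.sup prefixes $ f)
        λ c s → BP.sup-least _ _ λ w → TP.sup-upper prefixes (c ∷ w) f s)

  -- Induction on the word for all `f` at once: one unfolding bounds `g` at `prefix c $ f` by `g` at
  -- `f`.
  unfold-least : ∀ g → (unfold $ g) T.≤ g → ∀ w → prefixes w T.≤ g
  unfold-least g p []      f s = B.trans (PP.x≤x∨ᴸy f _ s) (p f s)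
  unfold-least g p (c ∷ w) f s =
    B.trans (unfold-least g p w (prefix c $ f) s)
      (B.trans (⋁[]-upper Sym-finite (λ d → var (there (here refl)) · prefixFormula d)
                 (f ∷ g ∷ []) c s)
        (B.trans (PP.y≤x∨ᴸy f _ s) (p f s)))

  reach≈sup-prefixes : ∀ f s → (reach $ f) s ≈ B.sup λ w → (prefixes w $ f) s
  reach≈sup-prefixes f s =
    B.antisym
      (TP.lfp-least unfold (T.sup prefixes) prefixes-prefixed f s)
      (BP.sup-least _ _ λ w → unfold-least reach (TP.lfp-prefixed unfold) w f s)

  δ : Q → Sym → F₀ Q
  δ q = proj₁ (Δ q)

  next : P.Carrier → Q → Sym → B.Carrier
  next f q c = component (lifting ♥) State (f ∷ []) (F₁ inj₁ (δ q c))

  -- The argument of the diamond in `prefix c`, with its meet taken in `𝔹` state by state so that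
  -- the guard lemmas apply.
  prefixArgument : P.Carrier → Sym → State → B.Carrier
  prefixArgument f c s = ⟪ proj₂ (step s) (inj₁ c) ⟫ ∧ᴸ component (lifting ♥) State (f ∷ []) (proj₁ (step s))

  prefixArgument-≤ : ∀ f c q d → prefixArgument f c (inj₂ (q , d)) ≤ next f q c
  prefixArgument-≤ f c q d =
    -- Equality of `inj₁ d` and `inj₁ c` is decided through `Sym`, so the label test computes to
    -- this decision.
    BP.guard-least (Finite⇒≟ Sym-finite d c) _ _ λ { refl → B.refl }

  prefixArgument-≥ : ∀ f c q → next f q c ≤ prefixArgument f c (inj₂ (q , c))
  prefixArgument-≥ f c q = BP.≤-guard (Finite⇒≟ Sym-finite c c) _ refl

  -- The support offers every letter at the single state `q`, but the guard kills all letters except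
  -- `c`, leaving one term of the join.
  diamond-prefixArgument : ∀ f c q → diamond F 𝔹 (Q × Sym) (prefixArgument f c ∘ inj₂) (A q) ≈ next f q c
  diamond-prefixArgument f c q = B.antisym
    (B.⋁-least _ _ λ { ((q′ , d) , t) → below q′ d (proj₁ (proj₁ (suppt-A q) t)) })
    (B.trans (prefixArgument-≥ f c q)
      (B.⋁-upper _ ((q , c) , proj₂ (suppt-A q) (refl , _))))
    where
    below : ∀ q′ d → q ≡ q′ → prefixArgument f c (inj₂ (q′ , d)) ≤ next f q c
    below _ d refl = prefixArgument-≤ f c q d

  -- The support is known for `A q` over `Q × Sym`, not for its image over `State`, so naturality of
  -- `◇` along `inj₂` precedes `is◇`. Naturality of `♥` along `inj₁` then restricts `f` to `Q`.
  prefix-inj₁ : ∀ c f q → (prefix c $ f) (inj₁ q) ≈ component (lifting ♥) Q (f ∘ inj₁ ∷ []) (δ q c)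
  prefix-inj₁ c f q =
    B.Eq.trans (component-cong (lifting ◇) (powerLattice-∧ᴸ State 𝔹 _ _) (F₁ inj₂ (A q)))
      (B.Eq.trans (B.Eq.sym (natural (lifting ◇) inj₂ (prefixArgument f c ∷ []) (A q)))
        (B.Eq.trans (is◇ _ _ (A q))
          (B.Eq.trans (diamond-prefixArgument f c q)
            (B.Eq.sym (natural (lifting ♥) inj₁ (f ∷ []) (δ q c))))))

  -- `v` is the word already absorbed into `f`. Moving `c` from `w` to the front of `v` is the
  -- defining clause of `_ʳ++_`, so the induction needs no list rewriting.
  prefixes-accept : ∀ w v f → (∀ q → f (inj₁ q) ≈ accept q v) →
                    ∀ q → (prefixes w $ f) (inj₁ q) ≈ accept q (w ʳ++ v)
  prefixes-accept []      v f p = p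
  prefixes-accept (c ∷ w) v f p = prefixes-accept w (c ∷ v) (prefix c $ f) λ q →
    B.Eq.trans (prefix-inj₁ c f q) (component-cong (lifting ♥) p (δ q c))

  final : P.Carrier
  final = ⟦ mod (letter ✓) [] ⟧ []

  final-accept : ∀ q → final (inj₁ q) ≈ accept q []
  -- The label of `inj₁ q` is an `if` on the acceptance bit, so its test for `✓` computes only after
  -- a split.
  final-accept q with proj₂ (Δ q)
  ... | true  = B.Eq.refl
  ... | false = B.Eq.refl

  reach-final≈val : (reach $ final) (inj₁ q₀) ≈ val
  reach-final≈val = B.Eq.trans (reach≈sup-prefixes final (inj₁ q₀)) (B.antisym
    (BP.sup-least _ _ λ w →
      B.trans (B.reflexive (accepts w)) (BP.sup-upper (accept q₀) (reverse w)))
    -- Reversal is an involution, so the value of `w` is attained at the index `reverse w`.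
    (BP.sup-least _ _ λ w →
      B.trans (B.reflexive (B.Eq.trans
                (B.Eq.reflexive (cong (accept q₀) (≡.sym (reverse-involutive w))))
                (B.Eq.sym (accepts (reverse w)))))
              (BP.sup-upper (λ v → (prefixes v $ final) (inj₁ q₀)) (reverse w))))
    where
    accepts : ∀ w → (prefixes w $ final) (inj₁ q₀) ≈ accept q₀ (reverse w)
    accepts w = prefixes-accept w [] final final-accept q₀

theorem3p4 :
    {ℓ m : Level} (F : SetFunctor ℓ) →
    PreservesInclusions F → PreservesWeakWidePullbacks F →
    (𝔹 : CompleteLattice ℓ) (Mod : Modalities m F 𝔹) →
    let open SetFunctor F
        open CompleteLattice 𝔹
        open Modalities Mod in
    (□ : Op 1) → Is□ F 𝔹 (lifting □) →
    (◇ : Op 1) → Is◇ F 𝔹 (lifting ◇) →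
    (𝔸 : Automaton Mod) (fin : Automaton.IsFinite 𝔸) →
    let open Automaton 𝔸 in
    (A : Q → F₀ (Q × Sym)) →
    (∀ q → suppt F (A q) ≐ (｛ q ｝ ⟨×⟩ U)) →
    let open Semantics (extend Mod Sym) (automatonCoalgebra 𝔸 fin A)
        φ = reachFormula 𝔸 fin ◇ in
    (⟦ φ ⟧₀ (inj₁ q₀) ≈ val) × ((val ≈ ⊤ᴸ) ⇔ (inj₁ q₀ ⊩ φ))
theorem3p4 F _ _ 𝔹 Mod _ _ ◇ is◇ 𝔸 fin A suppt-A =
  value , mk⇔ (B.Eq.trans value) (B.Eq.trans (B.Eq.sym value))
  where
  module B = CompleteLattice 𝔹
  value = Reachability.reach-final≈val ◇ is◇ 𝔸 fin A suppt-A
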